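{- Let $S_1$ and $S_2$ be two finite $\Gamma$-labelled forests. Over the class of all finite $\tau^+$-structures, if $\mathscr{W}(S_1)\not\subseteq \mathscr{W}(S_2)$, then $\mathrm{FO}\{S_1\}\not\subseteq \mathrm{FO}\{S_2\}$.
   Context: $\tau^+=\langle U,R,B,r\rangle$ where $R,B$ are binary relation symbols, $U$ a unary relation symbol and $r$ a constant symbol. $\Gamma=\{\exists,\forall\}$. A $\Gamma$-labelled forest is a finite disjoint union of rooted directed trees (arcs from father to child), nodes labelled $\exists$ or $\forall$. $\mathscr{W}(S)\subseteq\Gamma^*$ is the set of words read off $S$: for each directed path $(v_0,\dots,v_n)$ ($n\ge0$) the word of labels of $v_0,\dots,v_n$, together with all subsequences of such words. Formulas are in negation normal form. The quantifier structure $qs(\varphi)$: literal $\mapsto$ empty forest; conjunction/disjunction $\mapsto$ disjoint union; $\exists x\,\theta$ (resp. $\forall x\,\theta$) $\mapsto$ new node labelled $\exists$ (resp. $\forall$) with an arc to every root of $qs(\theta)$. $S\preceq_e S'$ means there is a label-preserving, not necessarily injective map $\iota$ from nodes of $S$ to nodes of $S'$ such that each arc $x\to y$ in $S$ gives a directed path of length $\ge1$ from $\iota(x)$ to $\iota(y)$ in $S'$. $\mathrm{FO}\{S\}$ is the set of properties (isomorphism-closed classes within the class considered) definable on that class by a first-order sentence $\theta$ with $qs(\theta)\preceq_e S$; $\mathrm{FO}\{S_1\}\not\subseteq\mathrm{FO}\{S_2\}$ means some property definable with quantifier structure $\preceq_e S_1$ is not definable by any sentence with quantifier structure $\preceq_e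 S_2$. -}

module Defs where

open import Data.Nat using (ℕ; suc)
open import Data.Fin using (Fin)
open import Data.Bool using (Bool; T; not)
open import Data.Vec using (Vec; lookup; _∷_)
open import Data.List using (List; []; _∷_; _++_)
open import Data.List.Relation.Binary.Sublist.Propositional using (_⊆_)
open import Data.Product using (Σ; _×_; ∃)
open import Data.Sum using (_⊎_)
open import Relation.Nullary using (¬_)
open import Relation.Binary.PropositionalEquality using (_≡_)
open import Relation.Binary.Construct.Closure.Transitive using (TransClosure)
open import Function.Bundles using (_⇔_; _↔_; Inverse)

data Γ : Set where
  ∃q ∀q : Γ

data Tree : Set where
  node : Γ → List Tree → Tree

Forest : Set
Forest = List Tree

mutual
  data TPos : Tree → Set where
    here  : ∀ {g ts} → TPos (node g ts)
    there : ∀ {g ts} → FPos ts → TPos (node g ts)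

  data FPos : Forest → Set where
    hd : ∀ {t ts} → TPos t → FPos (t ∷ ts)
    tl : ∀ {t ts} → FPos ts → FPos (t ∷ ts)

mutual
  tlabel : ∀ {t} → TPos t → Γ
  tlabel {node g ts} here = g
  tlabel (there p) = flabel p

  flabel : ∀ {F} → FPos F → Γ
  flabel (hd p) = tlabel p
  flabel (tl p) = flabel p

data IsRoot : ∀ {F} → FPos F → Set where
  hd-root : ∀ {g us ts} → IsRoot (hd {node g us} {ts} here)
  tl-root : ∀ {t ts} {p : FPos ts} → IsRoot p → IsRoot (tl {t} p)

mutual
  data TArc : ∀ {t} → TPos t → TPos t → Set where
    root-arc : ∀ {g ts} {q : FPos ts} → IsRoot q → TArc (here {g}) (there q)
    deep-arc : ∀ {g ts} {p q : FPos ts} → FArc p q → TArc (there {g} p) (there q)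

  data FArc : ∀ {F} → FPos F → FPos F → Set where
    hd-arc : ∀ {t ts} {p q : TPos t} → TArc p q → FArc (hd {t} {ts} p) (hd q)
    tl-arc : ∀ {t ts} {p q : FPos ts} → FArc p q → FArc (tl {t} p) (tl q)

data PathWord {F : Forest} : FPos F → List Γ → Set where
  single : ∀ {p} → PathWord p (flabel p ∷ [])
  step   : ∀ {p q w} → FArc p q → PathWord q w → PathWord p (flabel p ∷ w)

𝒲 : Forest → List Γ → Set
𝒲 S w = Σ (FPos S) λ p → Σ (List Γ) λ w′ → PathWord p w′ × (w ⊆ w′)

_⪯ₑ_ : Forest → Forest → Set
S ⪯ₑ S′ = Σ (FPos S → FPos S′) λ ι →
            ((p : FPos S) → flabel (ι p) ≡ flabel p)
          × ((p q : FPos S) → FArc p q → TransClosure FArc (ι p) (ι q))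

-- First-order logic over τ⁺ = ⟨U, R, B, r⟩ (negation normal form)

data Term (n : ℕ) : Set where
  var : Fin n → Term n
  cr  : Term n

data Fm (n : ℕ) : Set where
  U⁺ U⁻           : Term n → Fm n
  R⁺ R⁻ B⁺ B⁻     : Term n → Term n → Fm n
  eq⁺ eq⁻         : Term n → Term n → Fm n
  _∧′_ _∨′_       : Fm n → Fm n → Fm n
  ∃′ ∀′           : Fm (suc n) → Fm n

Sentence : Set
Sentence = Fm 0

qs : ∀ {n} → Fm n → Forest
qs (U⁺ _) = []
qs (U⁻ _) = []
qs (R⁺ _ _) = []
qs (R⁻ _ _) = []
qs (B⁺ _ _) = []
qs (B⁻ _ _) = []
qs (eq⁺ _ _) = []
qs (eq⁻ _ _) = []
qs (φ ∧′ ψ) = qs φ ++ qs ψ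
qs (φ ∨′ ψ) = qs φ ++ qs ψ
qs (∃′ φ) = node ∃q (qs φ) ∷ []
qs (∀′ φ) = node ∀q (qs φ) ∷ []

-- finite τ⁺-structures with universe Fin size (nonempty, since r is interpreted)
record Structure : Set where
  field
    size : ℕ
    Uᴬ   : Fin size → Bool
    Rᴬ   : Fin size → Fin size → Bool
    Bᴬ   : Fin size → Fin size → Bool
    rᴬ   : Fin size

open Structure

eval : (A : Structure) → ∀ {n} → Vec (Fin (size A)) n → Term n → Fin (size A)
eval A ρ (var i) = lookup ρ i
eval A ρ cr = rᴬ A

Sat : (A : Structure) → ∀ {n} → Fm n → Vec (Fin (size A)) n → Set
Sat A (U⁺ t) ρ = T (Uᴬ A (eval A ρ t))
Sat A (U⁻ t) ρ = T (not (Uᴬ A (eval A ρ t)))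
Sat A (R⁺ s t) ρ = T (Rᴬ A (eval A ρ s) (eval A ρ t))
Sat A (R⁻ s t) ρ = T (not (Rᴬ A (eval A ρ s) (eval A ρ t)))
Sat A (B⁺ s t) ρ = T (Bᴬ A (eval A ρ s) (eval A ρ t))
Sat A (B⁻ s t) ρ = T (not (Bᴬ A (eval A ρ s) (eval A ρ t)))
Sat A (eq⁺ s t) ρ = eval A ρ s ≡ eval A ρ t
Sat A (eq⁻ s t) ρ = ¬ (eval A ρ s ≡ eval A ρ t)
Sat A (φ ∧′ ψ) ρ = Sat A φ ρ × Sat A ψ ρ
Sat A (φ ∨′ ψ) ρ = Sat A φ ρ ⊎ Sat A ψ ρ
Sat A (∃′ φ) ρ = Σ (Fin (size A)) λ a → Sat A φ (a ∷ ρ)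
Sat A (∀′ φ) ρ = (a : Fin (size A)) → Sat A φ (a ∷ ρ)

_⊨_ : Structure → Sentence → Set
A ⊨ θ = Sat A θ Vec.[]
  where import Data.Vec as Vec

Defines : Sentence → (Structure → Set) → Set
Defines θ P = (A : Structure) → P A ⇔ (A ⊨ θ)

InFO : Forest → (Structure → Set) → Set
InFO S P = Σ Sentence λ θ → (qs θ ⪯ₑ S) × Defines θ P

Iso : Structure → Structure → Set
Iso A B = Σ (Fin (size A) ↔ Fin (size B)) λ f →
            let h = Inverse.to f in
            ((a : Fin (size A)) → Uᴬ B (h a) ≡ Uᴬ A a)
          × ((a b : Fin (size A)) → Rᴬ B (h a) (h b) ≡ Rᴬ A a b)
          × ((a b : Fin (size A)) → Bᴬ B (h a) (h b) ≡ Bᴬ A a b)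
          × (h (rᴬ A) ≡ rᴬ B)

IsoClosed : (Structure → Set) → Set
IsoClosed P = (A B : Structure) → Iso A B → P A → P B

_FO⊈_ : Forest → Forest → Set₁
S₁ FO⊈ S₂ = Σ (Structure → Set) λ P → IsoClosed P × InFO S₁ P × ¬ InFO S₂ P

_W⊈_ : Forest → Forest → Set
S₁ W⊈ S₂ = ¬ ((w : List Γ) → 𝒲 S₁ w → 𝒲 S₂ w)

{-# OPTIONS --safe #-}

-- For a word w let ψ_w(x) be U(x) if w is empty, and
--   ψ_{∃v}(x) = ∃y (R(x,y) ∧ ψ_v(y)) ∧ ∃y (B(x,y) ∧ ψ_v(y)),
--   ψ_{∀v}(x) = ∀y (R(x,y) → ψ_v(y)) ∨ ∀y (B(x,y) → ψ_v(y)).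
-- Every path of the quantifier structure of ψ_w(r) reads w, so it embeds in any forest having w as
-- a path word.  If w is not a word of S₂, then ψ_w(r) separates.  Consider trees in which a good
-- node at an ∃-level has many good and many bad children of either colour, while a bad node has
-- only bad children of one colour (its variant) and all kinds of children of the other colour;
-- dually at ∀-levels.  Good roots satisfy ψ_w, bad roots do not.  In the Ehrenfeucht–Fraïssé game
-- from a good to a bad tree Duplicator keeps an ancestor-closed matching in which matched nodes
-- root isomorphic trees, except that a good node may face a bad one when the quantifiers still to
-- come avoid the word v of their subtrees.  Such a mismatch passes to a child only when the first
-- letter of v is played; a deeper move costs nothing more, since the variant of the new bad node
-- can be chosen different from the colour in which Spoiler's path goes on.
module Submission where

open import Defs
open import Data.Bool using (Bool; true; false; T; not; _∧_; _∨_; if_then_else_)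
import Data.Bool.Properties as Bool
open import Data.Empty using (⊥)
open import Data.Fin using (Fin; zero; suc)
import Data.Fin.Properties as Fin
open import Data.List as List using (List; []; _∷_; _++_; map; length)
open import Data.List.Membership.Propositional using (_∈_)
open import Data.List.Properties using (length-map; map-∘)
open import Data.List.Relation.Binary.Sublist.Propositional using (_⊆_; _∷_; _∷ʳ_; ⊆-refl; ⊆-trans)
open import Data.List.Relation.Unary.All as All using (All; []; _∷_)
import Data.List.Relation.Unary.All.Properties as All
open import Data.List.Relation.Unary.AllPairs using ([]; _∷_)
open import Data.List.Relation.Unary.Any as Any using (Any; here; there)
import Data.List.Relation.Unary.Any.Properties as Any
open import Data.List.Relation.Unary.Unique.Propositional using (Unique)
open import Data.Nat using (ℕ; suc; _+_; _*_; _≤_; _<_; _⊔_; z≤n; s≤s)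
open import Data.Nat.Properties using (≤-trans; ≤-refl; ≤-reflexive; n≤1+n; m≤m⊔n; m≤n⊔m; +-monoʳ-≤; +-suc; m+n≤o⇒m≤o)
open import Data.Product using (Σ; _×_; _,_; proj₁; proj₂; ∃; ∃₂)
open import Data.Product.Function.NonDependent.Propositional using (_×-↔_)
open import Data.Product.Properties using (≡-dec)
open import Data.Sum using (_⊎_; inj₁; inj₂; [_,_]′)
open import Data.Sum.Function.Propositional using (_⊎-↔_)
open import Data.Unit using (⊤; tt)
open import Data.Vec as Vec using (Vec; []; _∷_; lookup)
open import Data.Vec.Properties using (lookup-map)
open import Function.Base using (_∘_; id)
open import Function.Bundles using (_↔_; Inverse; Equivalence; mk⇔; mk↔ₛ′)
open import Function.Properties.Inverse using (↔-refl; ↔-trans)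
open import Relation.Binary.Construct.Closure.Transitive using (TransClosure; [_]; _∷_) renaming (_++_ to _⁺++⁺_)
open import Relation.Binary.Definitions using (DecidableEquality)
open import Relation.Binary.PropositionalEquality using (_≡_; _≢_; refl; sym; trans; cong; cong₂; subst)
open import Relation.Nullary using (¬_; Dec; yes; no; does; contradiction; ¬?)
open import Relation.Nullary.Decidable using (decidable-stable; dec-true; dec-false)

Word : Set
Word = List Γ

_≟Γ_ : DecidableEquality Γ
∃q ≟Γ ∃q = yes refl
∃q ≟Γ ∀q = no λ ()
∀q ≟Γ ∃q = no λ ()
∀q ≟Γ ∀q = yes refl

open import Data.List.Relation.Binary.Sublist.DecPropositional _≟Γ_ using (_⊆?_)

-- Words of forests

-- Defined by recursion on the forest so that it follows the clauses of `qs`; `deep` permits gaps.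
-- `done` makes the empty word occur even in the empty forest, so that no forest avoids `[]`.
data Occurs : Word → Forest → Set where
  done : ∀ {F} → Occurs [] F
  take : ∀ {g w ts F} → Occurs w ts → Occurs (g ∷ w) (node g ts ∷ F)
  deep : ∀ {g w ts F} → Occurs w ts → Occurs w (node g ts ∷ F)
  skip : ∀ {w t F} → Occurs w F → Occurs w (t ∷ F)

occurs-++ˡ : ∀ {w F} G → Occurs w F → Occurs w (F ++ G)
occurs-++ˡ G done     = done
occurs-++ˡ G (take o) = take o
occurs-++ˡ G (deep o) = deep o
occurs-++ˡ G (skip o) = skip (occurs-++ˡ G o)

occurs-++ʳ : ∀ {w G} F → Occurs w G → Occurs w (F ++ G)
occurs-++ʳ []      o = o
occurs-++ʳ (t ∷ F) o = skip (occurs-++ʳ F o)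

-- Gaps are allowed between consecutive letters, because an embedding sends arcs only to paths.
data Descent {F : Forest} : FPos F → Word → Set where
  stop : ∀ {p} → Descent p (flabel p ∷ [])
  down : ∀ {p q w} → TransClosure FArc p q → Descent q w → Descent p (flabel p ∷ w)

arcs-map : ∀ {F G} (f : FPos F → FPos G) → (∀ {p q} → FArc p q → FArc (f p) (f q)) →
           ∀ {p q} → TransClosure FArc p q → TransClosure FArc (f p) (f q)
arcs-map f arc [ a ]    = [ arc a ]
arcs-map f arc (a ∷ as) = arc a ∷ arcs-map f arc as

descent-map : ∀ {F G} (f : FPos F → FPos G) → (∀ p → flabel (f p) ≡ flabel p) →
              (∀ {p q} → TransClosure FArc p q → TransClosure FArc (f p) (f q)) →
              ∀ {p w} → Descent p w → Descent (f p) w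
descent-map f lab arc (stop {p})   = subst (λ g → Descent (f p) (g ∷ [])) (lab p) stop
descent-map f lab arc (down {p} {w = w} as d) =
  subst (λ g → Descent (f p) (g ∷ w)) (lab p) (down (arc as) (descent-map f lab arc d))

inside : ∀ {g ts F} → FPos ts → FPos (node g ts ∷ F)
inside q = hd (there q)

inside-arc : ∀ {g ts F} {p q : FPos ts} → FArc p q → FArc (inside {g} {ts} {F} p) (inside q)
inside-arc a = hd-arc (deep-arc a)

root-above : ∀ {g ts F} (q : FPos ts) → TransClosure FArc (hd {node g ts} {F} here) (inside q)
root-above (hd {node _ _} here)      = [ hd-arc (root-arc hd-root) ]
root-above (hd {node _ _} (there q)) =
  hd-arc (root-arc hd-root) ∷ arcs-map inside inside-arc (root-above q)
-- The path is found in the tree without its first subtree `t`; `widen` puts `t` back.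
root-above {g} {t ∷ ts} {F} (tl q)   = arcs-map widen widen-arc (root-above {F = F} q)
  where
  widen : FPos (node g ts ∷ F) → FPos (node g (t ∷ ts) ∷ F)
  widen (hd here)      = hd here
  widen (hd (there p)) = inside (tl p)
  widen (tl p)         = tl p

  widen-arc : ∀ {p q} → FArc p q → FArc (widen p) (widen q)
  widen-arc (hd-arc (root-arc r)) = hd-arc (root-arc (tl-root r))
  widen-arc (hd-arc (deep-arc a)) = hd-arc (deep-arc (tl-arc a))
  widen-arc (tl-arc a)            = tl-arc a

occurs⇒descent : ∀ {g w F} → Occurs (g ∷ w) F → ∃ λ p → Descent {F} p (g ∷ w)
occurs⇒descent {w = []}    (take o) = hd here , stop
occurs⇒descent {w = _ ∷ _} (take o) with occurs⇒descent o
... | q , d = hd here , down (root-above q)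
                (descent-map inside (λ _ → refl) (arcs-map inside inside-arc) d)
occurs⇒descent (deep o) with occurs⇒descent o
... | q , d = inside q , descent-map inside (λ _ → refl) (arcs-map inside inside-arc) d
occurs⇒descent (skip o) with occurs⇒descent o
... | q , d = tl q , descent-map tl (λ _ → refl) (arcs-map tl tl-arc) d

prepend-arcs : ∀ {F} {p q : FPos F} {u} → TransClosure FArc p q → PathWord q u →
               ∃ λ u′ → PathWord p (flabel p ∷ u′) × (u ⊆ u′)
prepend-arcs [ a ]    pw = _ , step a pw , ⊆-refl
prepend-arcs (a ∷ as) pw with prepend-arcs as pw
... | _ , pw′ , sub = _ , step a pw′ , _ ∷ʳ sub

descent⇒𝒲 : ∀ {F} {p : FPos F} {w} → Descent p w → ∃ λ w′ → PathWord p w′ × (w ⊆ w′)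
descent⇒𝒲 stop = _ , single , ⊆-refl
descent⇒𝒲 (down as d) with descent⇒𝒲 d
... | _ , pw , sub with prepend-arcs as pw
...   | _ , pw′ , sub′ = _ , pw′ , refl ∷ ⊆-trans sub sub′

-- The embedding carries the chain of nodes to `S`, and filling the gaps there only lengthens the
-- word. Contrapositively, a non-empty word outside `𝒲 S` is avoided by every forest that embeds in
-- `S`.
occurs-⪯ₑ : ∀ {F S g w} → F ⪯ₑ S → Occurs (g ∷ w) F → 𝒲 S (g ∷ w)
occurs-⪯ₑ (ι , lab , arc) o with occurs⇒descent o
... | p , d = ι p , descent⇒𝒲 (descent-map ι lab extend d)
  where
  extend : ∀ {p q} → TransClosure FArc p q → TransClosure FArc (ι p) (ι q)
  extend [ a ]    = arc _ _ a
  extend (a ∷ as) = arc _ _ a ⁺++⁺ extend as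

-- Searching the path words of a forest

pathWord-inside : ∀ {g ts F p w} → PathWord p w → PathWord (inside {g} {ts} {F} p) w
pathWord-inside single      = single
pathWord-inside (step a pw) = step (inside-arc a) (pathWord-inside pw)

pathWord-inside⁻ : ∀ {g ts F p w} → PathWord (inside {g} {ts} {F} p) w → PathWord p w
pathWord-inside⁻ single                             = single
pathWord-inside⁻ (step (hd-arc (deep-arc a)) pw) = step a (pathWord-inside⁻ pw)

pathWord-tl : ∀ {t F p w} → PathWord p w → PathWord (tl {t} {F} p) w
pathWord-tl single      = single
pathWord-tl (step a pw) = step (tl-arc a) (pathWord-tl pw)

pathWord-tl⁻ : ∀ {t F p w} → PathWord (tl {t} {F} p) w → PathWord p w
pathWord-tl⁻ single               = single
pathWord-tl⁻ (step (tl-arc a) pw) = step a (pathWord-tl⁻ pw)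

-- Descending below a root labelled `g` turns `P` into `P ∘ (g ∷_)`; hence the arbitrary predicate
-- and the restriction to paths that start at a root.
search-roots : ∀ F (P : Word → Set) → (∀ w → Dec (P w)) →
               (∃₂ λ p w → IsRoot {F} p × PathWord p w × P w) ⊎
               (∀ {p w} → IsRoot {F} p → PathWord p w → ¬ P w)
search-roots []              P P? = inj₂ λ { {()} }
search-roots (node g ts ∷ F) P P?
  with P? (g ∷ []) | search-roots ts (P ∘ (g ∷_)) (P? ∘ (g ∷_)) | search-roots F P P?
... | yes Pg | _ | _ = inj₁ (hd here , _ , hd-root , single , Pg)
... | no _   | inj₁ (p , w , r , pw , Pw) | _ =
  inj₁ (hd here , _ , hd-root , step (hd-arc (root-arc r)) (pathWord-inside pw) , Pw)
... | no _   | inj₂ _ | inj₁ (p , w , r , pw , Pw) = inj₁ (tl p , w , tl-root r , pathWord-tl pw , Pw)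
... | no ¬Pg | inj₂ none | inj₂ none′ = inj₂ λ where
  hd-root     single                             → ¬Pg
  hd-root     (step (hd-arc (root-arc r)) pw) → none r (pathWord-inside⁻ pw)
  (tl-root r) pw                                 → none′ r (pathWord-tl⁻ pw)

search : ∀ F (P : Word → Set) → (∀ w → Dec (P w)) →
         (∃₂ λ p w → PathWord {F} p w × P w) ⊎ (∀ {p w} → PathWord {F} p w → ¬ P w)
search []              P P? = inj₂ λ { {()} }
search (node g ts ∷ F) P P?
  with search-roots (node g ts ∷ F) P P? | search ts P P? | search F P P?
... | inj₁ (p , w , _ , pw , Pw) | _ | _ = inj₁ (p , w , pw , Pw)
... | inj₂ _ | inj₁ (p , w , pw , Pw) | _ = inj₁ (inside p , w , pathWord-inside pw , Pw)
... | inj₂ _ | inj₂ _ | inj₁ (p , w , pw , Pw) = inj₁ (tl p , w , pathWord-tl pw , Pw)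
... | inj₂ none | inj₂ none₁ | inj₂ none₂ = inj₂ (none-at _)
  where
  none-at : ∀ p {w} → PathWord p w → ¬ P w
  none-at (hd here)      pw = none hd-root pw
  none-at (hd (there p)) pw = none₁ (pathWord-inside⁻ pw)
  none-at (tl p)         pw = none₂ (pathWord-tl⁻ pw)

𝒲? : ∀ F w → Dec (𝒲 F w)
𝒲? F w with search F (w ⊆_) (w ⊆?_)
... | inj₁ (p , w′ , pw , sub) = yes (p , w′ , pw , sub)
... | inj₂ none                = no λ { (_ , _ , pw , sub) → none pw sub }

-- The hypothesis is a negated universal, so the word has to be found by search. Full path words
-- suffice, because `𝒲 S₂` is closed under subsequences.
separating-pathWord : ∀ {S₁ S₂} → S₁ W⊈ S₂ → ∃₂ λ p w → PathWord {S₁} p w × ¬ 𝒲 S₂ w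
separating-pathWord {S₁} {S₂} ⊈ with search S₁ (¬_ ∘ 𝒲 S₂) (¬? ∘ 𝒲? S₂)
... | inj₁ found = found
... | inj₂ none  = contradiction included ⊈
  where
  included : ∀ w → 𝒲 S₁ w → 𝒲 S₂ w
  included w (_ , w′ , pw , sub) with decidable-stable (𝒲? S₂ w′) (none pw)
  ... | q , w″ , pw′ , sub′ = q , w″ , pw′ , ⊆-trans sub sub′

-- The sentences

weaken : ∀ {n} → Term n → Term (suc n)
weaken (var i) = var (suc i)
weaken cr      = cr

edge⁺ edge⁻ : ∀ {n} → Bool → Term n → Term n → Fm n
edge⁺ true  = R⁺
edge⁺ false = B⁺
edge⁻ true  = R⁻
edge⁻ false = B⁻

mutual
  ψ : ∀ {n} → Word → Term n → Fm n
  ψ []       t = U⁺ t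
  ψ (∃q ∷ v) t = ψ∃ true v t ∧′ ψ∃ false v t
  ψ (∀q ∷ v) t = ψ∀ true v t ∨′ ψ∀ false v t

  ψ∃ ψ∀ : ∀ {n} → Bool → Word → Term n → Fm n
  ψ∃ c v t = ∃′ (edge⁺ c (weaken t) (var zero) ∧′ ψ v (var zero))
  ψ∀ c v t = ∀′ (edge⁻ c (weaken t) (var zero) ∨′ ψ v (var zero))

doubled : Word → Forest
doubled []      = []
doubled (g ∷ v) = node g (doubled v) ∷ node g (doubled v) ∷ []

qs-ψ : ∀ {n} v (t : Term n) → qs (ψ v t) ≡ doubled v
qs-ψ []       t = refl
qs-ψ (∃q ∷ v) t = cong (λ F → node ∃q F ∷ node ∃q F ∷ []) (qs-ψ v (var zero))
qs-ψ (∀q ∷ v) t = cong (λ F → node ∀q F ∷ node ∀q F ∷ []) (qs-ψ v (var zero))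

-- Both copies of a level, one for each colour, go to the same node of the path; embeddings need not
-- be injective.
place : ∀ {S p w} → PathWord {S} p w → FPos (doubled w) → FPos S
place {p = p} single     _                   = p
place {p = p} (step a pw) (hd here)           = p
place         (step a pw) (hd (there x))      = place pw x
place {p = p} (step a pw) (tl (hd here))      = p
place         (step a pw) (tl (hd (there x))) = place pw x

place-root : ∀ {S p w} (pw : PathWord {S} p w) {x} → IsRoot x → place pw x ≡ p
place-root single      _                 = refl
place-root (step a pw) hd-root           = refl
place-root (step a pw) (tl-root hd-root) = refl

place-label : ∀ {S p w} (pw : PathWord {S} p w) x → flabel (place pw x) ≡ flabel x
place-label single      (hd here)           = refl
place-label single      (tl (hd here))      = refl
place-label (step a pw) (hd here)           = refl
place-label (step a pw) (hd (there x))      = place-label pw x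
place-label (step a pw) (tl (hd here))      = refl
place-label (step a pw) (tl (hd (there x))) = place-label pw x

place-arc : ∀ {S p w} (pw : PathWord {S} p w) {x y} → FArc x y → FArc (place pw x) (place pw y)
place-arc single      (hd-arc (root-arc ()))
place-arc single      (hd-arc (deep-arc ()))
place-arc single      (tl-arc (hd-arc (root-arc ())))
place-arc single      (tl-arc (hd-arc (deep-arc ())))
place-arc (step a pw) (hd-arc (root-arc r))          = subst (FArc _) (sym (place-root pw r)) a
place-arc (step a pw) (hd-arc (deep-arc b))          = place-arc pw b
place-arc (step a pw) (tl-arc (hd-arc (root-arc r))) = subst (FArc _) (sym (place-root pw r)) a
place-arc (step a pw) (tl-arc (hd-arc (deep-arc b))) = place-arc pw b

qs-ψ-⪯ₑ : ∀ {S p w n} (t : Term n) → PathWord {S} p w → qs (ψ w t) ⪯ₑ S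
qs-ψ-⪯ₑ {S} {w = w} t pw = subst (_⪯ₑ S) (sym (qs-ψ w t))
  (place pw , place-label pw , λ _ _ a → [ place-arc pw a ])

-- Isomorphism invariance

module _ (A B : Structure) (iso : Iso A B) where
  open Structure
  private
    f = proj₁ iso
    h = Inverse.to f
    U≡ = proj₁ (proj₂ iso)
    R≡ = proj₁ (proj₂ (proj₂ iso))
    B≡ = proj₁ (proj₂ (proj₂ (proj₂ iso)))
    r≡ = proj₂ (proj₂ (proj₂ (proj₂ iso)))

  eval-iso : ∀ {n} (ρ : Vec (Fin (size A)) n) t → eval B (Vec.map h ρ) t ≡ h (eval A ρ t)
  eval-iso ρ (var i) = lookup-map i h ρ
  eval-iso ρ cr      = sym r≡

  private
    unary : ∀ {n} (ρ : Vec _ n) t → Uᴬ A (eval A ρ t) ≡ Uᴬ B (eval B (Vec.map h ρ) t)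
    unary ρ t = trans (sym (U≡ _)) (cong (Uᴬ B) (sym (eval-iso ρ t)))

    red : ∀ {n} (ρ : Vec _ n) s t →
          Rᴬ A (eval A ρ s) (eval A ρ t) ≡ Rᴬ B (eval B (Vec.map h ρ) s) (eval B (Vec.map h ρ) t)
    red ρ s t = trans (sym (R≡ _ _)) (cong₂ (Rᴬ B) (sym (eval-iso ρ s)) (sym (eval-iso ρ t)))

    blue : ∀ {n} (ρ : Vec _ n) s t →
           Bᴬ A (eval A ρ s) (eval A ρ t) ≡ Bᴬ B (eval B (Vec.map h ρ) s) (eval B (Vec.map h ρ) t)
    blue ρ s t = trans (sym (B≡ _ _)) (cong₂ (Bᴬ B) (sym (eval-iso ρ s)) (sym (eval-iso ρ t)))

    injective : ∀ {x y} → h x ≡ h y → x ≡ y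
    injective {x} {y} e = trans (sym (Inverse.strictlyInverseʳ f x))
      (trans (cong (Inverse.from f) e) (Inverse.strictlyInverseʳ f y))

  sat-iso : ∀ {n} (φ : Fm n) ρ → Sat A φ ρ → Sat B φ (Vec.map h ρ)
  sat-iso (U⁺ t)    ρ x = subst T (unary ρ t) x
  sat-iso (U⁻ t)    ρ x = subst (T ∘ not) (unary ρ t) x
  sat-iso (R⁺ s t)  ρ x = subst T (red ρ s t) x
  sat-iso (R⁻ s t)  ρ x = subst (T ∘ not) (red ρ s t) x
  sat-iso (B⁺ s t)  ρ x = subst T (blue ρ s t) x
  sat-iso (B⁻ s t)  ρ x = subst (T ∘ not) (blue ρ s t) x
  sat-iso (eq⁺ s t) ρ e = trans (eval-iso ρ s) (trans (cong h e) (sym (eval-iso ρ t)))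
  sat-iso (eq⁻ s t) ρ ne e =
    ne (injective (trans (sym (eval-iso ρ s)) (trans e (eval-iso ρ t))))
  sat-iso (φ ∧′ χ)  ρ (x , y) = sat-iso φ ρ x , sat-iso χ ρ y
  sat-iso (φ ∨′ χ)  ρ (inj₁ x) = inj₁ (sat-iso φ ρ x)
  sat-iso (φ ∨′ χ)  ρ (inj₂ y) = inj₂ (sat-iso χ ρ y)
  sat-iso (∃′ φ)    ρ (a , x) = h a , sat-iso φ (a ∷ ρ) x
  sat-iso (∀′ φ)    ρ x b = subst (λ c → Sat B φ (c ∷ Vec.map h ρ))
    (Inverse.strictlyInverseˡ f b) (sat-iso φ (Inverse.from f b ∷ ρ) (x (Inverse.from f b)))

-- Quantifier rank, and the good and bad trees

rank : ∀ {n} → Fm n → ℕ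
rank (φ ∧′ χ) = rank φ ⊔ rank χ
rank (φ ∨′ χ) = rank φ ⊔ rank χ
rank (∃′ φ)   = suc (rank φ)
rank (∀′ φ)   = suc (rank φ)
rank _        = 0

module Trees (N : ℕ) where

  -- colour (true for R, false for B), requested status, variant, copy number
  Letter : Set
  Letter = Bool × Bool × Bool × Fin N

  colour : Letter → Bool
  colour = proj₁

  copy : Letter → Fin N
  copy (_ , _ , _ , k) = k

  _≟ᴸ_ : DecidableEquality Letter
  _≟ᴸ_ = ≡-dec Bool._≟_ (≡-dec Bool._≟_ (≡-dec Bool._≟_ Fin._≟_))

  infixr 5 _◂_
  data Node : Word → Set where
    root : ∀ {v} → Node v
    _◂_  : ∀ {q v} → Letter → Node v → Node (q ∷ v)

  letters : ℕ
  letters = 2 * (2 * (2 * N))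

  letter↔ : Fin letters ↔ Letter
  letter↔ = ↔-trans Fin.*↔× (Fin.2↔Bool ×-↔ ↔-trans Fin.*↔× (Fin.2↔Bool ×-↔
            ↔-trans Fin.*↔× (Fin.2↔Bool ×-↔ ↔-refl)))

  count : Word → ℕ
  count []      = 1
  count (_ ∷ v) = 1 + letters * count v

  node↔ : ∀ v → Fin (count v) ↔ Node v
  node↔ []      = ↔-trans Fin.1↔⊤ (mk↔ₛ′ (λ _ → root) (λ _ → tt) (λ { root → refl }) (λ _ → refl))
  node↔ (q ∷ v) = ↔-trans (Fin.+↔⊎ {1}) (↔-trans
    (Fin.1↔⊤ ⊎-↔ ↔-trans Fin.*↔× (letter↔ ×-↔ node↔ v)) unfold)
    where
    unfold : (⊤ ⊎ (Letter × Node v)) ↔ Node (q ∷ v)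
    unfold = mk↔ₛ′ (λ { (inj₁ _) → root ; (inj₂ (a , x)) → a ◂ x })
                   (λ { root → inj₁ tt ; (a ◂ x) → inj₂ (a , x) })
                   (λ { root → refl ; (_ ◂ _) → refl })
                   (λ { (inj₁ _) → refl ; (inj₂ _) → refl })

  edge : Bool → ∀ {v} → Node v → Node v → Bool
  edge c root    root          = false
  edge c root    (a ◂ root)    = does (colour a Bool.≟ c)
  edge c root    (_ ◂ (_ ◂ _)) = false
  edge c (_ ◂ _) root          = false
  edge c (a ◂ x) (b ◂ y)       = does (a ≟ᴸ b) ∧ edge c x y

  -- status (true for good) and variant
  Type : Set
  Type = Bool × Bool

  status variant : Type → Bool
  status  = proj₁
  variant = proj₂

  -- The first argument is the father's status. Conjunction makes every child of a bad father bad
  -- and leaves the requests at a good father alone; disjunction is dual. One formula thus serves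
  -- both kinds of father.
  combine : Γ → Bool → Bool → Bool
  combine ∃q = _∧_
  combine ∀q = _∨_

  -- The requested status is overridden exactly at the forbidden children, so that good and bad trees
  -- share all their nodes and edges and differ only in U.
  childType : Γ → Type → Letter → Type
  childType q (s₀ , d₀) (c , s , d , _) = (if does (c Bool.≟ d₀) then combine q s₀ s else s) , d

  absorbing : Γ → Bool
  absorbing ∃q = false
  absorbing ∀q = true

  combine-idem : ∀ q s → combine q s s ≡ s
  combine-idem ∃q = Bool.∧-idem
  combine-idem ∀q = Bool.∨-idem

  combine-absorbing : ∀ q s → combine q (absorbing q) s ≡ absorbing q
  combine-absorbing ∃q s = refl
  combine-absorbing ∀q s = refl

  -- Used for good ∃-nodes and bad ∀-nodes: by idempotence they have children of their own status in
  -- either colour.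
  childType-inherit : ∀ q τ c d k → status (childType q τ (c , status τ , d , k)) ≡ status τ
  childType-inherit q (s , d₀) c _ _ with does (c Bool.≟ d₀)
  ... | true  = combine-idem q s
  ... | false = refl

  -- Used for bad ∃-nodes and good ∀-nodes: in the variant colour the absorbing status overrides
  -- every request.
  childType-restrict : ∀ q τ b → status τ ≡ absorbing q → colour b ≡ variant τ →
                       status (childType q τ b) ≡ absorbing q
  childType-restrict q (_ , d₀) (_ , s , _) refl refl
    rewrite dec-true (d₀ Bool.≟ d₀) refl = combine-absorbing q s

  -- The default `false` at inner nodes hides their status, which shows only through the nodes of
  -- full depth below them.
  leaf : ∀ {v} → Type → Node v → Bool
  leaf {[]}    τ root    = status τ
  leaf {_ ∷ _} τ root    = false
  leaf {q ∷ _} τ (a ◂ x) = leaf (childType q τ a) x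

  tree : Word → Type → Structure
  tree w τ = record
    { size = count w
    ; Uᴬ   = λ i → leaf τ (to i)
    ; Rᴬ   = λ i j → edge true (to i) (to j)
    ; Bᴬ   = λ i j → edge false (to i) (to j)
    ; rᴬ   = from root
    }
    where open Inverse (node↔ w)

  -- Truth of the sentences in the trees

  -- An inner node indexed by the word `v` still below it, which `Node w` does not record.
  data Prefix : Word → Word → Set where
    []  : ∀ {v} → Prefix v v
    _∷_ : ∀ {q w v} → Letter → Prefix w v → Prefix (q ∷ w) v

  plug : ∀ {w v} → Prefix w v → Node v → Node w
  plug []      x = x
  plug (a ∷ π) x = a ◂ plug π x

  typeAt : ∀ {w v} → Type → Prefix w v → Type
  typeAt τ []                = τ
  typeAt τ (_∷_ {q = q} a π) = typeAt (childType q τ a) π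

  _▹_ : ∀ {w q v} → Prefix w (q ∷ v) → Letter → Prefix w v
  []      ▹ b = b ∷ []
  (a ∷ π) ▹ b = a ∷ (π ▹ b)

  plug-▹ : ∀ {w q v} (π : Prefix w (q ∷ v)) b x → plug (π ▹ b) x ≡ plug π (b ◂ x)
  plug-▹ []      b x = refl
  plug-▹ (a ∷ π) b x = cong (a ◂_) (plug-▹ π b x)

  typeAt-▹ : ∀ {w q v} τ (π : Prefix w (q ∷ v)) b → typeAt τ (π ▹ b) ≡ childType q (typeAt τ π) b
  typeAt-▹ τ []      b = refl
  typeAt-▹ τ (a ∷ π) b = typeAt-▹ _ π b

  leaf-plug : ∀ {w} τ (π : Prefix w []) → leaf τ (plug π root) ≡ status (typeAt τ π)
  leaf-plug τ []      = refl
  leaf-plug τ (a ∷ π) = leaf-plug _ π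

  edge-plug : ∀ {w q v} (π : Prefix w (q ∷ v)) b → edge (colour b) (plug π root) (plug π (b ◂ root)) ≡ true
  edge-plug []      b = dec-true (colour b Bool.≟ colour b) refl
  edge-plug (a ∷ π) b = cong₂ _∧_ (dec-true (a ≟ᴸ a) refl) (edge-plug π b)

  edge-plug⁻ : ∀ {w q v} c (π : Prefix w (q ∷ v)) y → edge c (plug π root) y ≡ true →
               ∃ λ b → colour b ≡ c × y ≡ plug π (b ◂ root)
  edge-plug⁻ c [] (b ◂ root) e with colour b Bool.≟ c
  ... | yes eq = b , eq , refl
  edge-plug⁻ c (a ∷ π) (a′ ◂ y) e with a ≟ᴸ a′
  ... | yes refl with edge-plug⁻ c π y e
  ...   | b , eq , refl = b , eq , refl

  module Truth (w : Word) (τ : Type) (k : Fin N) where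
    open Inverse (node↔ w)

    𝔗 : Structure
    𝔗 = tree w τ

    At : ∀ {v n} → Prefix w v → Vec (Fin (count w)) n → Term n → Set
    At π ρ t = to (eval 𝔗 ρ t) ≡ plug π root

    eval-weaken : ∀ {n} (t : Term n) ρ i → eval 𝔗 (i ∷ ρ) (weaken t) ≡ eval 𝔗 ρ t
    eval-weaken (var _) ρ i = refl
    eval-weaken cr      ρ i = refl

    edge⁺-sound : ∀ c {n} (ρ : Vec _ n) s t → Sat 𝔗 (edge⁺ c s t) ρ →
                  edge c (to (eval 𝔗 ρ s)) (to (eval 𝔗 ρ t)) ≡ true
    edge⁺-sound true  ρ s t = Equivalence.to Bool.T-≡
    edge⁺-sound false ρ s t = Equivalence.to Bool.T-≡

    edge⁺-complete : ∀ c {n} (ρ : Vec _ n) s t → edge c (to (eval 𝔗 ρ s)) (to (eval 𝔗 ρ t)) ≡ true →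
                     Sat 𝔗 (edge⁺ c s t) ρ
    edge⁺-complete true  ρ s t = Equivalence.from Bool.T-≡
    edge⁺-complete false ρ s t = Equivalence.from Bool.T-≡

    edge⁻-sound : ∀ c {n} (ρ : Vec _ n) s t → Sat 𝔗 (edge⁻ c s t) ρ →
                  edge c (to (eval 𝔗 ρ s)) (to (eval 𝔗 ρ t)) ≢ true
    edge⁻-sound true  ρ s t e⁻ e = subst (T ∘ not) e e⁻
    edge⁻-sound false ρ s t e⁻ e = subst (T ∘ not) e e⁻

    edge⁻-complete : ∀ c {n} (ρ : Vec _ n) s t → edge c (to (eval 𝔗 ρ s)) (to (eval 𝔗 ρ t)) ≡ false →
                     Sat 𝔗 (edge⁻ c s t) ρ
    edge⁻-complete true  ρ s t e = subst (T ∘ not) (sym e) tt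
    edge⁻-complete false ρ s t e = subst (T ∘ not) (sym e) tt

    child : ∀ {q v} → Prefix w (q ∷ v) → Letter → Fin (count w)
    child π b = from (plug (π ▹ b) root)

    child-at : ∀ {q v n} (π : Prefix w (q ∷ v)) b (ρ : Vec _ n) → At (π ▹ b) (child π b ∷ ρ) (var zero)
    child-at π b ρ = strictlyInverseˡ _

    child-edge : ∀ {q v n} (π : Prefix w (q ∷ v)) b (ρ : Vec _ n) t → At π ρ t →
                 edge (colour b) (to (eval 𝔗 (child π b ∷ ρ) (weaken t))) (to (child π b)) ≡ true
    child-edge π b ρ t at rewrite eval-weaken t ρ (child π b) | at
      | strictlyInverseˡ (plug (π ▹ b) root) | plug-▹ π b root = edge-plug π b

    edge-child : ∀ {q v n} (π : Prefix w (q ∷ v)) c (ρ : Vec _ n) t → At π ρ t → ∀ i →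
                 edge c (to (eval 𝔗 (i ∷ ρ) (weaken t))) (to i) ≡ true →
                 ∃ λ b → colour b ≡ c × At (π ▹ b) (i ∷ ρ) (var zero)
    edge-child π c ρ t at i e rewrite eval-weaken t ρ i | at with edge-plug⁻ c π (to i) e
    ... | b , eq , at′ = b , eq , trans at′ (sym (plug-▹ π b root))

    HasStatus : ∀ {v} → Bool → Prefix w v → Set
    HasStatus s π = status (typeAt τ π) ≡ s

    inherit : ∀ {q v s} (π : Prefix w (q ∷ v)) c → HasStatus s π → HasStatus s (π ▹ (c , s , true , k))
    inherit {q} π c refl = trans (cong status (typeAt-▹ τ π _)) (childType-inherit q (typeAt τ π) c true k)

    restrict : ∀ {q v} (π : Prefix w (q ∷ v)) b → HasStatus (absorbing q) π →
               colour b ≡ variant (typeAt τ π) → HasStatus (absorbing q) (π ▹ b)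
    restrict {q} π b st eq = trans (cong status (typeAt-▹ τ π b)) (childType-restrict q (typeAt τ π) b st eq)

    mutual
      -- At an ∃-level `inherit` supplies a good child of each colour. At a ∀-level the disjunct of
      -- the variant colour is chosen, since all children of that colour are good by `restrict`.
      good⇒ψ : ∀ v {n} (π : Prefix w v) (ρ : Vec _ n) t → At π ρ t → HasStatus true π → Sat 𝔗 (ψ v t) ρ
      good⇒ψ []       π ρ t at g = Equivalence.from Bool.T-≡
        (trans (cong (leaf τ) at) (trans (leaf-plug τ π) g))
      good⇒ψ (∃q ∷ v) π ρ t at g = good⇒ψ∃ true , good⇒ψ∃ false
        where
        good⇒ψ∃ : ∀ c → Sat 𝔗 (ψ∃ c v t) ρ
        good⇒ψ∃ c = child π b , edge⁺-complete c _ _ _ (child-edge π b ρ t at) ,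
                    good⇒ψ v (π ▹ b) _ _ (child-at π b ρ) (inherit π c g)
          where b = c , true , true , k
      good⇒ψ (∀q ∷ v) π ρ t at g = side (variant (typeAt τ π)) good⇒ψ∀
        where
        good⇒ψ∀ : Sat 𝔗 (ψ∀ (variant (typeAt τ π)) v t) ρ
        good⇒ψ∀ i with Bool._≟_ (edge (variant (typeAt τ π)) (to (eval 𝔗 (i ∷ ρ) (weaken t))) (to i)) true
        ... | no ne = inj₁ (edge⁻-complete (variant (typeAt τ π)) _ (weaken t) (var zero) (Bool.¬-not ne))
        ... | yes e with edge-child π _ ρ t at i e
        ...   | b , eq , at′ = inj₂ (good⇒ψ v (π ▹ b) _ _ at′ (restrict π b g eq))

        side : ∀ c → Sat 𝔗 (ψ∀ c v t) ρ → Sat 𝔗 (ψ (∀q ∷ v) t) ρ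
        side true  = inj₁
        side false = inj₂

      -- Dually, at an ∃-level the conjunct of the variant colour fails, and at a ∀-level a bad
      -- child refutes the disjunct of each colour.
      bad⇒¬ψ : ∀ v {n} (π : Prefix w v) (ρ : Vec _ n) t → At π ρ t → HasStatus false π → ¬ Sat 𝔗 (ψ v t) ρ
      bad⇒¬ψ []       π ρ t at g sat with () ← trans (sym (Equivalence.to Bool.T-≡ sat))
        (trans (cong (leaf τ) at) (trans (leaf-plug τ π) g))
      bad⇒¬ψ (∃q ∷ v) π ρ t at g sat with side (variant (typeAt τ π)) sat
        where
        side : ∀ c → Sat 𝔗 (ψ (∃q ∷ v) t) ρ → Sat 𝔗 (ψ∃ c v t) ρ
        side true  = proj₁
        side false = proj₂
      ... | i , e , sat′ with edge-child π _ ρ t at i (edge⁺-sound (variant (typeAt τ π)) _ _ _ e)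
      ...   | b , eq , at′ = bad⇒¬ψ v (π ▹ b) _ _ at′ (restrict π b g eq) sat′
      bad⇒¬ψ (∀q ∷ v) π ρ t at g = [ bad⇒¬ψ∀ true , bad⇒¬ψ∀ false ]′
        where
        bad⇒¬ψ∀ : ∀ c → ¬ Sat 𝔗 (ψ∀ c v t) ρ
        bad⇒¬ψ∀ c sat = [ (λ e⁻ → edge⁻-sound c _ (weaken t) (var zero) e⁻ (child-edge π b ρ t at))
                        , bad⇒¬ψ v (π ▹ b) _ _ (child-at π b ρ) (inherit π c g) ]′ (sat (child π b))
          where b = c , false , true , k

    good⇒⊨ : status τ ≡ true → 𝔗 ⊨ ψ w cr
    good⇒⊨ = good⇒ψ w [] [] cr (strictlyInverseˡ root)

    bad⇒⊭ : status τ ≡ false → ¬ (𝔗 ⊨ ψ w cr)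
    bad⇒⊭ = bad⇒¬ψ w [] [] cr (strictlyInverseˡ root)

  -- Matchings

  -- The root is always matched to the root; an entry (a , a′ , m) matches child a to child a′ and
  -- their subtrees by m.
  Matching : Word → Set
  Matching []      = ⊤
  Matching (_ ∷ v) = List (Letter × Letter × Matching v)

  Entry : Word → Set
  Entry v = Letter × Letter × Matching v

  leftKey rightKey : ∀ {v} → Entry v → Letter
  leftKey  (a , _ , _) = a
  rightKey (_ , a′ , _) = a′

  Matches : ∀ {v} → Matching v → Node v → Node v → Set
  Matches M root    root      = ⊤
  Matches M root    (_ ◂ _)   = ⊥
  Matches M (_ ◂ _) root      = ⊥
  Matches M (a ◂ x) (a′ ◂ x′) = Any (λ (b , b′ , m) → a ≡ b × a′ ≡ b′ × Matches m x x′) M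

  Mismatch : Bool → Set → Type → Type → Set
  Mismatch b A τ τ′ = status τ ≡ b × status τ′ ≡ not b × A

  Compatible : Bool → Set → Type → Type → Set
  Compatible b A τ τ′ = τ ≡ τ′ ⊎ Mismatch b A τ τ′

  -- A mismatch has status b on the left, Av v says that the remaining quantifiers avoid v, and L
  -- bounds the number of matched children of each node.
  mutual
    Valid : Bool → (Word → Set) → ℕ → ∀ v → Type → Type → Matching v → Set
    Valid b Av L []      τ τ′ M = Compatible b (Av []) τ τ′
    Valid b Av L (q ∷ v) τ τ′ M = Compatible b (Av (q ∷ v)) τ τ′
      × All (ValidEntry b Av L q v τ τ′) M
      × Unique (map leftKey M) × Unique (map rightKey M) × length M ≤ L

    ValidEntry : Bool → (Word → Set) → ℕ → ∀ q v → Type → Type → Entry v → Set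
    ValidEntry b Av L q v τ τ′ (a , a′ , m) =
      colour a ≡ colour a′ × Valid b Av L v (childType q τ a) (childType q τ′ a′) m

  compatible-map : ∀ {b τ τ′} {A A′ : Set} → (A → A′) → Compatible b A τ τ′ → Compatible b A′ τ τ′
  compatible-map f (inj₁ eq)             = inj₁ eq
  compatible-map f (inj₂ (st , st′ , a)) = inj₂ (st , st′ , f a)

  compatible-sym : ∀ {b τ τ′ A} → Compatible b A τ τ′ → Compatible (not b) A τ′ τ
  compatible-sym     (inj₁ eq)             = inj₁ (sym eq)
  compatible-sym {b} (inj₂ (st , st′ , a)) = inj₂ (st′ , trans st (sym (Bool.not-involutive b)) , a)

  valid-mono : ∀ {b L L′} {Av Av′ : Word → Set} → (∀ {v} → Av v → Av′ v) → L ≤ L′ →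
               ∀ v {τ τ′ M} → Valid b Av L v τ τ′ M → Valid b Av′ L′ v τ τ′ M
  valid-mono f L≤L′ []      c = compatible-map f c
  valid-mono f L≤L′ (q ∷ v) (c , es , u , u′ , l) =
    compatible-map f c , All.map (λ (eq , ok) → eq , valid-mono f L≤L′ v ok) es ,
    u , u′ , ≤-trans l L≤L′

  -- Swapping the sides turns Spoiler's universal moves, made in the right tree, into moves on the
  -- left, so that one extension lemma covers both quantifiers.
  transpose : ∀ v → Matching v → Matching v
  transpose []      M = tt
  transpose (_ ∷ v) M = map (λ (a , a′ , m) → a′ , a , transpose v m) M

  transpose-matches : ∀ {v} {M : Matching v} x x′ → Matches M x x′ → Matches (transpose v M) x′ x
  transpose-matches root    root      _  = tt
  transpose-matches (a ◂ x) (a′ ◂ x′) i =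
    Any.map⁺ (Any.map (λ (eq , eq′ , j) → eq′ , eq , transpose-matches x x′ j) i)

  transpose-valid : ∀ {b Av L} v {τ τ′ M} → Valid b Av L v τ τ′ M →
                    Valid (not b) Av L v τ′ τ (transpose v M)
  transpose-valid [] c = compatible-sym c
  transpose-valid (q ∷ v) {M = M} (c , es , u , u′ , l) =
    compatible-sym c ,
    All.map⁺ (All.map (λ (eq , ok) → sym eq , transpose-valid v ok) es) ,
    subst Unique (map-∘ M) u′ , subst Unique (map-∘ M) u ,
    ≤-trans (≤-reflexive (length-map _ M)) l

  witness : ∀ {A : Set} {P Q : A → Set} {xs} → All P xs → Any Q xs → ∃ λ x → P x × Q x
  witness ps i = _ , All.lookupAny ps i

  -- `Matches` only asserts that some entry fits. Unique keys force two such entries to coincide, so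
  -- that an induction can continue inside a single inner matching.
  unique-meet : ∀ {A K : Set} {P Q : A → Set} (key : A → K) {xs} → Unique (map key xs) →
                (∀ {x y} → P x → Q y → key x ≡ key y) → Any P xs → Any Q xs → Any (λ x → P x × Q x) xs
  unique-meet key _       eq (here p)  (here q)  = here (p , q)
  unique-meet key (u ∷ _) eq (here p)  (there j) =
    contradiction j (All.All¬⇒¬Any (All.map (λ ne q → ne (eq p q)) (All.map⁻ u)))
  unique-meet key (u ∷ _) eq (there i) (here q)  =
    contradiction i (All.All¬⇒¬Any (All.map (λ ne p → ne (sym (eq p q))) (All.map⁻ u)))
  unique-meet key (_ ∷ u) eq (there i) (there j) = there (unique-meet key u eq i j)

  matches-functional : ∀ {b Av L} v {τ τ′ M} → Valid b Av L v τ τ′ M → ∀ x x′ y y′ →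
                       Matches M x x′ → Matches M y y′ → x ≡ y → x′ ≡ y′
  matches-functional v _ root root root root _ _ _ = refl
  matches-functional (q ∷ v) (_ , es , u , _) (a ◂ x) (a′ ◂ x′) (a ◂ x) (b′ ◂ y′) i j refl
    with witness es (unique-meet leftKey u (λ (p , _) (p′ , _) → trans (sym p) p′) i j)
  ... | _ , (_ , ok) , (_ , eq₁ , ix) , (_ , eq₂ , jy) =
    cong₂ _◂_ (trans eq₁ (sym eq₂)) (matches-functional v ok x x′ x y′ ix jy refl)

  matches-injective : ∀ {b Av L} v {τ τ′ M} → Valid b Av L v τ τ′ M → ∀ x x′ y y′ →
                      Matches M x x′ → Matches M y y′ → x′ ≡ y′ → x ≡ y
  matches-injective v ok x x′ y y′ i j = matches-functional v (transpose-valid v ok) x′ x y′ y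
    (transpose-matches x x′ i) (transpose-matches y y′ j)

  -- Matched nodes have equal depth, and unique keys on both sides make two paths separate at the
  -- same level in both trees. The colour of the last letter agrees by `ValidEntry`.
  matches-edge : ∀ {b Av L} v {τ τ′ M} → Valid b Av L v τ τ′ M → ∀ c x x′ y y′ →
                 Matches M x x′ → Matches M y y′ → edge c x y ≡ edge c x′ y′
  matches-edge v _ c root root root root _ _ = refl
  matches-edge (q ∷ v) (_ , es , _) c root root (a ◂ root) (a′ ◂ root) _ j with witness es j
  ... | _ , (eq , _) , refl , refl , _ = cong (λ d → does (d Bool.≟ c)) eq
  matches-edge (q ∷ v) (_ , es , _) c root root (a ◂ root) (a′ ◂ (_ ◂ _)) _ j
    with () ← proj₂ (proj₂ (proj₂ (All.lookupAny es j)))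
  matches-edge (q ∷ v) (_ , es , _) c root root (a ◂ (_ ◂ _)) (a′ ◂ root) _ j
    with () ← proj₂ (proj₂ (proj₂ (All.lookupAny es j)))
  matches-edge (q ∷ v) _ c root root (a ◂ (_ ◂ _)) (a′ ◂ (_ ◂ _)) _ j = refl
  matches-edge (q ∷ v) _ c (_ ◂ _) (_ ◂ _) root root _ _ = refl
  matches-edge (q ∷ v) (_ , es , u , u′ , _) c (a ◂ x) (a′ ◂ x′) (d ◂ y) (d′ ◂ y′) i j
    with a ≟ᴸ d | a′ ≟ᴸ d′
  ... | yes refl | a′≟d′
    with witness es (unique-meet leftKey u (λ (p , _) (p′ , _) → trans (sym p) p′) i j)
  ...   | _ , (_ , ok) , (_ , refl , ix) , (_ , refl , jy)
    rewrite dec-true a′≟d′ refl = matches-edge v ok c x x′ y y′ ix jy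
  matches-edge (q ∷ v) (_ , es , u , u′ , _) c (a ◂ x) (a′ ◂ x′) (d ◂ y) (d′ ◂ y′) i j
      | no _ | no _ = refl
  -- Paths that separate on the left but not on the right would need two entries with the same right
  -- key.
  matches-edge (q ∷ v) (_ , es , u , u′ , _) c (a ◂ x) (a′ ◂ x′) (d ◂ y) (d′ ◂ y′) i j
      | no ne | yes refl
    with witness es (unique-meet rightKey u′ (λ (_ , p , _) (_ , p′ , _) → trans (sym p) p′) i j)
  ...   | _ , _ , (refl , _) , (refl , _) = contradiction refl ne

  -- Status is visible only at full depth, where a mismatch would require `Av []`.
  matches-leaf : ∀ {b Av L} → ¬ Av [] → ∀ v {τ τ′ M} → Valid b Av L v τ τ′ M → ∀ x x′ →
                 Matches M x x′ → leaf τ x ≡ leaf τ′ x′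
  matches-leaf ¬av []      (inj₁ refl)         root root _ = refl
  matches-leaf ¬av []      (inj₂ (_ , _ , av)) root root _ = contradiction av ¬av
  matches-leaf ¬av (q ∷ v) _                   root root _ = refl
  matches-leaf ¬av (q ∷ v) (_ , es , _) (a ◂ x) (a′ ◂ x′) i with witness es i
  ... | _ , (_ , ok) , refl , refl , ix = matches-leaf ¬av v ok x x′ ix

  -- Extending a matching by one move

  -- If every copy number were listed, its position would inject `Fin N` into fewer than `N` places.
  fresh : (ks : List (Fin N)) → length ks < N → ∃ λ k → ¬ k ∈ ks
  fresh ks short = Fin.¬∀⟶∃¬ N (_∈ ks) (λ k → Any.any? (k Fin.≟_) ks) λ all →
    let i , j , i<j , eq = Fin.pigeonhole short (Any.index ∘ all)
    in Fin.<⇒≢ i<j (trans (Any.lookup-index (all i))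
         (trans (cong (List.lookup ks) eq) (sym (Any.lookup-index (all j)))))

  -- The quantifier with which Spoiler moves on the left, when the left tree has status `b`. Only a
  -- level with this same letter can force a mismatch onto a child.
  advancing : Bool → Γ
  advancing true  = ∃q
  advancing false = ∀q

  -- Requesting the status that child a has under τ makes it appear under τ′ as well, unless τ′ forbids it.
  relabel : Γ → Type → Letter → Bool → Fin N → Letter
  relabel q τ a d k = colour a , status (childType q τ a) , d , k

  childType-clear : ∀ q τ τ′ a k → colour a ≢ variant τ′ →
                    childType q τ a ≡ childType q τ′ (relabel q τ a (variant (childType q τ a)) k)
  childType-clear q τ (_ , d′) a k ne rewrite dec-false (colour a Bool.≟ d′) ne = refl

  -- Requesting the status already obtained combines it with the father's status a second time, to
  -- no effect.
  childType-idem : ∀ q τ a k →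
                   childType q τ a ≡ childType q τ (relabel q τ a (variant (childType q τ a)) k)
  childType-idem q  (s₀ , d₀) (c , s , d , _) k with c Bool.≟ d₀
  childType-idem q  (s₀ , d₀) (c , s , d , _) k | no _  = refl
  childType-idem ∃q (s₀ , d₀) (c , s , d , _) k | yes _ = cong (_, d) (lem s₀ s)
    where
    lem : ∀ s₀ s → s₀ ∧ s ≡ s₀ ∧ (s₀ ∧ s)
    lem true  _ = refl
    lem false _ = refl
  childType-idem ∀q (s₀ , d₀) (c , s , d , _) k | yes _ = cong (_, d) (lem s₀ s)
    where
    lem : ∀ s₀ s → s₀ ∨ s ≡ s₀ ∨ (s₀ ∨ s)
    lem true  _ = refl
    lem false _ = refl

  -- The right father refuses a request only in its variant colour, at a level with letter
  -- `advancing b`, and for status `b`. The variant `d` of the child then remains free.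
  childType-mismatch : ∀ b q τ τ′ a → status τ′ ≡ not b →
    (∀ k → childType q τ a ≡ childType q τ′ (relabel q τ a (variant (childType q τ a)) k)) ⊎
    (q ≡ advancing b × status (childType q τ a) ≡ b ×
     (∀ d k → childType q τ′ (relabel q τ a d k) ≡ (not b , d)))
  childType-mismatch b q τ (_ , d′) a refl
    with colour a Bool.≟ d′ | status (childType q τ a)
  childType-mismatch b     q  τ (_ , d′) a refl | no _  | s     = inj₁ λ _ → refl
  childType-mismatch true  ∃q τ (_ , d′) a refl | yes _ | true  = inj₂ (refl , refl , λ _ _ → refl)
  childType-mismatch true  ∃q τ (_ , d′) a refl | yes _ | false = inj₁ λ _ → refl
  childType-mismatch true  ∀q τ (_ , d′) a refl | yes _ | s     = inj₁ λ _ → refl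
  childType-mismatch false ∀q τ (_ , d′) a refl | yes _ | true  = inj₁ λ _ → refl
  childType-mismatch false ∀q τ (_ , d′) a refl | yes _ | false = inj₂ (refl , refl , λ _ _ → refl)
  childType-mismatch false ∃q τ (_ , d′) a refl | yes _ | s     = inj₁ λ _ → refl

  Clear : ∀ {v} → Node v → Bool → Set
  Clear root    d = ⊤
  Clear (a ◂ _) d = colour a ≢ d

  clear : ∀ {v} (x : Node v) → ∃ (Clear x)
  clear root    = true , tt
  clear (a ◂ _) = not (colour a) , Bool.not-¬ refl

  -- `Av` and `Av′` stand for avoidance before and after the quantifier played. By `keep` old
  -- mismatches stay legal; by `advance` a mismatch may descend one level when that quantifier is
  -- the first letter of its word.
  module Extend (b : Bool) (Av Av′ : Word → Set) (L : ℕ) (L<N : L < N)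
                (keep : ∀ {v} → Av v → Av′ v) (advance : ∀ {v} → Av (advancing b ∷ v) → Av′ v) where

    Branch : ∀ v → Type → Type → Node v → Set
    Branch v τ τ′ x = ∃₂ λ M x′ → Matches {v} M x x′ × Valid b Av′ (suc L) v τ τ′ M

    bare : ∀ v {τ τ′} → Compatible b (Av′ v) τ τ′ → Branch v τ τ′ root
    bare []      c = tt , root , tt , c
    bare (q ∷ v) c = [] , root , tt , c , [] , [] , [] , z≤n

    -- Only the top of the branch can be mismatched: by `Clear` the right-hand node honours the
    -- first request, after which the types on both sides agree and stay equal.
    branch : ∀ v τ τ′ (x : Node v) →
             τ ≡ τ′ ⊎ (Mismatch b (Av′ v) τ τ′ × Clear x (variant τ′)) → Branch v τ τ′ x
    branch v τ τ′ root (inj₁ eq)       = bare v (inj₁ eq)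
    branch v τ τ′ root (inj₂ (mm , _)) = bare v (inj₂ mm)
    branch (q ∷ v) τ τ′ (a ◂ x) how =
      let m , x′ , i , ok = branch v (childType q τ a) (childType q τ′ a′) x (inj₁ (same how))
      in (a , a′ , m) ∷ [] , a′ ◂ x′ , here (refl , refl , i) ,
         compatible how , (refl , ok) ∷ [] , [] ∷ [] , [] ∷ [] , s≤s z≤n
      where
      a′ : Letter
      a′ = relabel q τ a (variant (childType q τ a)) (copy a)

      same : τ ≡ τ′ ⊎ (Mismatch b (Av′ (q ∷ v)) τ τ′ × Clear (_◂_ {q} a x) (variant τ′)) →
             childType q τ a ≡ childType q τ′ a′
      same (inj₁ refl)     = childType-idem q τ a (copy a)
      same (inj₂ (_ , ne)) = childType-clear q τ τ′ a (copy a) ne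

      compatible : τ ≡ τ′ ⊎ (Mismatch b (Av′ (q ∷ v)) τ τ′ × Clear (_◂_ {q} a x) (variant τ′)) →
                   Compatible b (Av′ (q ∷ v)) τ τ′
      compatible (inj₁ eq)       = inj₁ eq
      compatible (inj₂ (mm , _)) = inj₂ mm

    answer : ∀ q v τ τ′ a (x : Node v) k → Compatible b (Av (q ∷ v)) τ τ′ →
             ∃ λ a′ → colour a ≡ colour a′ × copy a′ ≡ k × Branch v (childType q τ a) (childType q τ′ a′) x
    answer q v τ τ′ a x k (inj₁ refl) =
      relabel q τ a (variant (childType q τ a)) k , refl , refl , branch v _ _ x (inj₁ (childType-idem q τ a k))
    answer q v τ τ′ a x k (inj₂ (st , st′ , av)) with childType-mismatch b q τ τ′ a st′
    ... | inj₁ eq = relabel q τ a (variant (childType q τ a)) k , refl , refl , branch v _ _ x (inj₁ (eq k))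
    -- The mismatch is passed to the child at the cost of the played letter, with a variant that
    -- differs from the next colour on the path.
    ... | inj₂ (refl , st₁ , ct) with clear x
    ...   | d , free = relabel q τ a d k , refl , refl , branch v _ _ x
      (inj₂ ((st₁ , cong status (ct d k) , advance av) , subst (Clear x) (sym (cong variant (ct d k))) free))

    Extension : ∀ v → Type → Type → Matching v → Node v → Set
    Extension v τ τ′ M x = ∃₂ λ M′ x′ → Matches {v} M′ x x′ ×
      (∀ y y′ → Matches M y y′ → Matches M′ y y′) × Valid b Av′ (suc L) v τ τ′ M′

    mutual
      extend : ∀ v {τ τ′} M (x : Node v) → Valid b Av L v τ τ′ M → Extension v τ τ′ M x
      extend v M root ok = M , root , tt , (λ _ _ i → i) , valid-mono keep (n≤1+n L) v ok
      extend (q ∷ v) {τ} {τ′} M (a ◂ x) (c , es , u , u′ , l) with extend-old q v M a x es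
      ... | inj₁ (M′ , a′ , x′ , i , M⊆M′ , es′ , eq , eq′) =
        M′ , a′ ◂ x′ , i , monotone , compatible-map keep c , es′ ,
        subst Unique eq u , subst Unique eq′ u′ ,
        ≤-trans (≤-reflexive (trans (sym (length-map leftKey M′))
                                  (trans (sym (cong length eq)) (length-map leftKey M))))
                (≤-trans l (n≤1+n L))
        where
        monotone : ∀ y y′ → Matches M y y′ → Matches M′ y y′
        monotone root    root    j = tt
        monotone (_ ◂ _) (_ ◂ _) j = M⊆M′ j
      ... | inj₂ new with fresh (map (copy ∘ rightKey) M)
                                (≤-trans (s≤s (≤-trans (≤-reflexive (length-map _ M)) l)) L<N)
      ...   | k , unused with answer q v τ τ′ a x k c
      ...     | a′ , col , refl , m , x′ , i , ok =
        (a , a′ , m) ∷ M , a′ ◂ x′ , here (refl , refl , i) , monotone ,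
        compatible-map keep c ,
        (col , ok) ∷ All.map (λ (eq , ok′) → eq , valid-mono keep (n≤1+n L) v ok′) es ,
        new ∷ u ,
        All.map⁺ (All.map (λ ne eq → ne (cong copy eq)) (All.map⁻ (All.¬Any⇒All¬ _ unused))) ∷ u′ ,
        s≤s l
        where
        monotone : ∀ y y′ → Matches M y y′ → Matches {q ∷ v} ((a , a′ , m) ∷ M) y y′
        monotone root    root    j = tt
        monotone (_ ◂ _) (_ ◂ _) j = there j

      -- Only an inner matching grows, so the keys are unchanged and uniqueness and length carry
      -- over.
      extend-old : ∀ q v {τ τ′} M a (x : Node v) → All (ValidEntry b Av L q v τ τ′) M →
        (Σ (List (Entry v)) λ M′ → ∃₂ λ a′ x′ → Matches {q ∷ v} M′ (a ◂ x) (a′ ◂ x′) ×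
          (∀ {d d′ y y′} → Matches {q ∷ v} M (d ◂ y) (d′ ◂ y′) → Matches {q ∷ v} M′ (d ◂ y) (d′ ◂ y′)) ×
          All (ValidEntry b Av′ (suc L) q v τ τ′) M′ ×
          map leftKey M ≡ map leftKey M′ × map rightKey M ≡ map rightKey M′) ⊎
        All (a ≢_) (map leftKey M)
      extend-old q v []                 a x [] = inj₂ []
      extend-old q v ((a₁ , a₂ , m) ∷ M) a x ((col , ok) ∷ es) with a ≟ᴸ a₁
      ... | yes refl with extend v m x ok
      ...   | m′ , x′ , i , m⊆m′ , ok′ =
        inj₁ ((a₁ , a₂ , m′) ∷ M , a₂ , x′ , here (refl , refl , i) , monotone ,
              (col , ok′) ∷ All.map (λ (eq , ok″) → eq , valid-mono keep (n≤1+n L) v ok″) es , refl , refl)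
        where
        monotone : ∀ {d d′ y y′} → Matches {q ∷ v} ((a₁ , a₂ , m) ∷ M) (d ◂ y) (d′ ◂ y′) →
                   Matches {q ∷ v} ((a₁ , a₂ , m′) ∷ M) (d ◂ y) (d′ ◂ y′)
        monotone (here (eq , eq′ , j)) = here (eq , eq′ , m⊆m′ _ _ j)
        monotone (there j)             = there j
      extend-old q v ((a₁ , a₂ , m) ∷ M) a x ((col , ok) ∷ es) | no ne with extend-old q v M a x es
      ...   | inj₁ (M′ , a′ , x′ , i , M⊆M′ , es′ , eq , eq′) =
        inj₁ ((a₁ , a₂ , m) ∷ M′ , a′ , x′ , there i , monotone ,
              (col , valid-mono keep (n≤1+n L) v ok) ∷ es′ , cong (a₁ ∷_) eq , cong (a₂ ∷_) eq′)
        where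
        monotone : ∀ {d d′ y y′} → Matches {q ∷ v} ((a₁ , a₂ , m) ∷ M) (d ◂ y) (d′ ◂ y′) →
                   Matches {q ∷ v} ((a₁ , a₂ , m) ∷ M′) (d ◂ y) (d′ ◂ y′)
        monotone (here h)  = here h
        monotone (there j) = there (M⊆M′ j)
      ...   | inj₂ new = inj₂ (ne ∷ new)

  -- Preservation of sentences that avoid the word

  Avoids : Forest → Word → Set
  Avoids F v = ¬ Occurs v F

  avoids-∷ : ∀ {g F v} → Avoids (node g F ∷ []) v → Avoids F v
  avoids-∷ av o = av (deep o)

  avoids-++ˡ : ∀ {F} G {v} → Avoids (F ++ G) v → Avoids F v
  avoids-++ˡ G av o = av (occurs-++ˡ G o)

  avoids-++ʳ : ∀ F {G v} → Avoids (F ++ G) v → Avoids G v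
  avoids-++ʳ F av o = av (occurs-++ʳ F o)

  ¬avoids-[] : ∀ {F} → ¬ Avoids F []
  ¬avoids-[] av = av done

  empty : ∀ v → Matching v
  empty []      = tt
  empty (_ ∷ _) = []

  empty-valid : ∀ {b Av} v {τ τ′} → Compatible b (Av v) τ τ′ → Valid b Av 0 v τ τ′ (empty v)
  empty-valid []      c = c
  empty-valid (_ ∷ _) c = c , [] , [] , [] , z≤n

  module Preservation (w : Word) where
    open Inverse (node↔ w)

    good bad : Type
    good = true , true
    bad  = false , true

    𝔄 𝔅 : Structure
    𝔄 = tree w good
    𝔅 = tree w bad

    to-injective : ∀ {i j} → to i ≡ to j → i ≡ j
    to-injective {i} {j} e = trans (sym (strictlyInverseʳ i)) (trans (cong from e) (strictlyInverseʳ j))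

    Position : Forest → ℕ → Matching w → Set
    Position F L M = Valid true (Avoids F) L w good bad M

    Related : ∀ {n} → Matching w → Vec (Fin (count w)) n → Vec (Fin (count w)) n → Set
    Related M ρ ρ′ = ∀ i → Matches M (to (lookup ρ i)) (to (lookup ρ′ i))

    related-∷ : ∀ {n M i i′} {ρ ρ′ : Vec _ n} →
                Matches M (to i) (to i′) → Related M ρ ρ′ → Related M (i ∷ ρ) (i′ ∷ ρ′)
    related-∷ m rel zero    = m
    related-∷ m rel (suc j) = rel j

    term-related : ∀ {n M} {ρ ρ′ : Vec _ n} → Related M ρ ρ′ →
                   ∀ t → Matches M (to (eval 𝔄 ρ t)) (to (eval 𝔅 ρ′ t))
    term-related rel (var i) = rel i
    term-related rel cr rewrite strictlyInverseˡ root = tt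

    module _ {n F L M} {ρ ρ′ : Vec _ n} (ok : Position F L M) (rel : Related M ρ ρ′) where
      leaf-same : ∀ t → leaf good (to (eval 𝔄 ρ t)) ≡ leaf bad (to (eval 𝔅 ρ′ t))
      leaf-same t = matches-leaf ¬avoids-[] w ok _ _ (term-related rel t)

      edge-same : ∀ c s t → edge c (to (eval 𝔄 ρ s)) (to (eval 𝔄 ρ t)) ≡
                            edge c (to (eval 𝔅 ρ′ s)) (to (eval 𝔅 ρ′ t))
      edge-same c s t = matches-edge w ok c _ _ _ _ (term-related rel s) (term-related rel t)

      equal⇒ : ∀ s t → eval 𝔄 ρ s ≡ eval 𝔄 ρ t → eval 𝔅 ρ′ s ≡ eval 𝔅 ρ′ t
      equal⇒ s t e = to-injective
        (matches-functional w ok _ _ _ _ (term-related rel s) (term-related rel t) (cong to e))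

      equal⇐ : ∀ s t → eval 𝔅 ρ′ s ≡ eval 𝔅 ρ′ t → eval 𝔄 ρ s ≡ eval 𝔄 ρ t
      equal⇐ s t e = to-injective
        (matches-injective w ok _ _ _ _ (term-related rel s) (term-related rel t) (cong to e))

    answer-∃ : ∀ {n F L M} {ρ ρ′ : Vec _ n} → L < N → Position (node ∃q F ∷ []) L M →
              Related M ρ ρ′ → ∀ i →
              ∃₂ λ M′ i′ → Position F (suc L) M′ × Related M′ (i ∷ ρ) (i′ ∷ ρ′)
    answer-∃ {F = F} {L} {M} {ρ} {ρ′} L<N ok rel i
      with Extend.extend true (Avoids (node ∃q F ∷ [])) (Avoids F) L L<N avoids-∷ (λ av o → av (take o))
             w M (to i) ok
    ... | M′ , x′ , m , M⊆M′ , ok′ = M′ , from x′ , ok′ ,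
      related-∷ {ρ = ρ} {ρ′} (subst (Matches M′ (to i)) (sym (strictlyInverseˡ x′)) m) (λ j → M⊆M′ _ _ (rel j))

    -- Spoiler moves in `𝔅`: the transposed matching is extended with `b` set to `false` and
    -- transposed back.
    answer-∀ : ∀ {n F L M} {ρ ρ′ : Vec _ n} → L < N → Position (node ∀q F ∷ []) L M →
              Related M ρ ρ′ → ∀ i′ →
              ∃₂ λ M′ i → Position F (suc L) M′ × Related M′ (i ∷ ρ) (i′ ∷ ρ′)
    answer-∀ {F = F} {L} {M} {ρ} {ρ′} L<N ok rel i′
      with Extend.extend false (Avoids (node ∀q F ∷ [])) (Avoids F) L L<N avoids-∷ (λ av o → av (take o))
             w (transpose w M) (to i′) (transpose-valid w ok)
    ... | M′ , x , m , M⊆M′ , ok′ = transpose w M′ , from x , transpose-valid w ok′ ,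
      related-∷ {ρ = ρ} {ρ′}
        (subst (λ y → Matches (transpose w M′) y (to i′)) (sym (strictlyInverseˡ x)) (transpose-matches _ _ m))
        (λ j → transpose-matches _ _ (M⊆M′ _ _ (transpose-matches _ _ (rel j))))

    -- `L` grows by one with each quantifier while the rank drops, so the inequality gives `L < N`
    -- at every move.
    preserve : ∀ {n} (θ : Fm n) {L M} {ρ ρ′ : Vec _ n} → Position (qs θ) L M → Related M ρ ρ′ →
               L + rank θ ≤ N → Sat 𝔄 θ ρ → Sat 𝔅 θ ρ′
    preserve (U⁺ t)    ok rel _ = subst T (leaf-same ok rel t)
    preserve (U⁻ t)    ok rel _ = subst (T ∘ not) (leaf-same ok rel t)
    preserve (R⁺ s t)  ok rel _ = subst T (edge-same ok rel true s t)
    preserve (R⁻ s t)  ok rel _ = subst (T ∘ not) (edge-same ok rel true s t)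
    preserve (B⁺ s t)  ok rel _ = subst T (edge-same ok rel false s t)
    preserve (B⁻ s t)  ok rel _ = subst (T ∘ not) (edge-same ok rel false s t)
    preserve (eq⁺ s t) ok rel _ = equal⇒ ok rel s t
    preserve (eq⁻ s t) ok rel _ ne e = ne (equal⇐ ok rel s t e)
    preserve (φ ∧′ χ) {L} ok rel l (x , y) =
      preserve φ (valid-mono (avoids-++ˡ (qs χ)) ≤-refl w ok)
        rel (≤-trans (+-monoʳ-≤ L (m≤m⊔n _ _)) l) x ,
      preserve χ (valid-mono (avoids-++ʳ (qs φ)) ≤-refl w ok)
        rel (≤-trans (+-monoʳ-≤ L (m≤n⊔m (rank φ) _)) l) y
    preserve (φ ∨′ χ) {L} ok rel l (inj₁ x) =
      inj₁ (preserve φ (valid-mono (avoids-++ˡ (qs χ)) ≤-refl w ok)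
        rel (≤-trans (+-monoʳ-≤ L (m≤m⊔n _ _)) l) x)
    preserve (φ ∨′ χ) {L} ok rel l (inj₂ y) =
      inj₂ (preserve χ (valid-mono (avoids-++ʳ (qs φ)) ≤-refl w ok)
        rel (≤-trans (+-monoʳ-≤ L (m≤n⊔m (rank φ) _)) l) y)
    preserve (∃′ φ) {L} {ρ = ρ} {ρ′} ok rel l (i , x) rewrite +-suc L (rank φ)
      with answer-∃ {ρ = ρ} {ρ′} (m+n≤o⇒m≤o (suc L) l) ok rel i
    ... | M′ , i′ , ok′ , rel′ = i′ , preserve φ ok′ rel′ l x
    preserve (∀′ φ) {L} {ρ = ρ} {ρ′} ok rel l x i′ rewrite +-suc L (rank φ)
      with answer-∀ {ρ = ρ} {ρ′} (m+n≤o⇒m≤o (suc L) l) ok rel i′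
    ... | M′ , i , ok′ , rel′ = preserve φ ok′ rel′ l (x i)

    ⊨-preserved : (θ : Sentence) → ¬ Occurs w (qs θ) → rank θ ≤ N → 𝔄 ⊨ θ → 𝔅 ⊨ θ
    -- Only the roots are matched at first; good may face bad there because `θ` avoids `w`.
    ⊨-preserved θ av l = preserve θ (empty-valid w (inj₂ (refl , refl , av))) (λ ()) l

-- Separation by a missing path word

theorem3p23 : (S₁ S₂ : Forest) → S₁ W⊈ S₂ → S₁ FO⊈ S₂
theorem3p23 S₁ S₂ ⊈ with separating-pathWord ⊈
... | p , w , pw , w∉ = (_⊨ ψ w cr) , (λ A B iso → sat-iso A B iso (ψ w cr) []) ,
                        (ψ w cr , qs-ψ-⪯ₑ cr pw , λ _ → mk⇔ id id) , undefinable
  where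
  avoids : ∀ {p w θ} → PathWord {S₁} p w → ¬ 𝒲 S₂ w → qs {0} θ ⪯ₑ S₂ → ¬ Occurs w (qs θ)
  -- The case split exposes that a path word is non-empty.
  avoids single     w∉ emb o = w∉ (occurs-⪯ₑ emb o)
  avoids (step _ _) w∉ emb o = w∉ (occurs-⪯ₑ emb o)

  undefinable : ¬ InFO S₂ (_⊨ ψ w cr)
  undefinable (θ , emb , defines) =
    bad⇒⊭ refl (Equivalence.from (defines 𝔅) (⊨-preserved θ (avoids {θ = θ} pw w∉ emb) (n≤1+n _)
      (Equivalence.to (defines 𝔄) (good⇒⊨ refl))))
    where
    -- The successor provides the copy `zero` even when `θ` has rank 0.
    open Trees (suc (rank θ))
    open Preservation w
    open Truth w good zero using (good⇒⊨)
    open Truth w bad zero using (bad⇒⊭)
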